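{- Let $\Delta\ge 4$ and $n\ge \Delta+2$ be integers. Consider the linear program in the real variables $m_{i,j}$, $1\le i\le j\le \Delta$: \[ \max \sum_{1\le i\le j\le \Delta} (i-j)^2\, m_{i,j} \] subject to \[ \sum_{1\le i\le j\le \Delta} \Bigl(\frac{1}{i}+\frac{1}{j}\Bigr) m_{i,j} = n,\qquad \sum_{1\le i\le j\le \Delta} m_{i,j} = n-1,\qquad m_{i,j}\ge 0 \ \text{ for all } 1\le i\le j\le \Delta. \] Then this problem admits a unique optimal solution, namely \[ m_{1,\Delta}=\frac{(\Delta-2)n+(\Delta+2)}{\Delta},\qquad m_{2,\Delta}=\frac{2(n-\Delta-1)}{\Delta}, \] and $m_{i,j}=0$ for all $(i,j)\notin\{(1,\Delta),(2,\Delta)\}$.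
   Context: This linear program is the relaxation of maximizing the $\sigma$-irregularity $\sigma(T)=\sum_{uv\in E(T)}(d(u)-d(v))^2$ over trees $T$ of order $n$ and maximum degree $\Delta$, where $m_{i,j}$ stands for the number of edges joining a vertex of degree $i$ to a vertex of degree $j$. -}

module Defs where

open import Algebra.Bundles using (CommutativeMonoid)
import Algebra.Properties.CommutativeSemigroup as CommutativeSemigroupProperties
open import Data.Bool using (Bool; if_then_else_; _∧_)
open import Data.Fin using (Fin; toℕ)
open import Data.Fin.Properties using (nonZeroIndex)
open import Data.Integer as ℤ using (ℤ; +_)
open import Data.Nat as ℕ using (ℕ; suc; _⊔_)
import Data.Nat.Properties as ℕ
open import Data.Product using (_×_; _,_; ∃-syntax)
open import Data.Rational as ℚ using (ℚ; 0ℚ; 1ℚ; ½; ∣_∣)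
import Data.Rational.Properties as ℚ
open import Data.Vec.Functional using (foldr)
open import Relation.Binary.PropositionalEquality using (_≡_; sym; trans; cong; cong₂; subst; module ≡-Reasoning)
open import Relation.Nullary.Decidable using (⌊_⌋)

-- A real number is a Cauchy sequence of rationals; equality of reals is _≃_, not _≡_.

Cauchy : (ℕ → ℚ) → Set
Cauchy x = ∀ ε → 0ℚ ℚ.< ε →
  ∃[ N ] (∀ m n → N ℕ.≤ m → N ℕ.≤ n → ∣ x m ℚ.- x n ∣ ℚ.< ε)

record ℝ : Set where
  constructor mkℝ
  field
    seq    : ℕ → ℚ
    cauchy : Cauchy seq

open ℝ public

infix  4 _≃_ _≤_
infixl 6 _+_
infixl 7 _*_

_≃_ : ℝ → ℝ → Set
x ≃ y = ∀ ε → 0ℚ ℚ.< ε →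
  ∃[ N ] (∀ n → N ℕ.≤ n → ∣ seq x n ℚ.- seq y n ∣ ℚ.< ε)

_≤_ : ℝ → ℝ → Set
x ≤ y = ∀ ε → 0ℚ ℚ.< ε →
  ∃[ N ] (∀ n → N ℕ.≤ n → seq x n ℚ.< seq y n ℚ.+ ε)

private
  open CommutativeSemigroupProperties
    (CommutativeMonoid.commutativeSemigroup ℚ.+-0-commutativeMonoid)
    using (interchange)

  abstract
    *-pos : ∀ {p q} → 0ℚ ℚ.< p → 0ℚ ℚ.< q → 0ℚ ℚ.< p ℚ.* q
    *-pos {p} {q} 0<p 0<q = ℚ.positive⁻¹ (p ℚ.* q)
      {{ℚ.pos*pos⇒pos p {{ℚ.positive 0<p}} q {{ℚ.positive 0<q}}}}

    0<½ : 0ℚ ℚ.< ½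
    0<½ = ℚ.positive⁻¹ ½

    const-cauchy : ∀ q → Cauchy (λ _ → q)
    const-cauchy q ε 0<ε = 0 , λ _ _ _ _ →
      subst (λ r → ∣ r ∣ ℚ.< ε) (sym (ℚ.+-inverseʳ q)) 0<ε

    +-cauchy : ∀ {x y} → Cauchy x → Cauchy y → Cauchy (λ n → x n ℚ.+ y n)
    +-cauchy {x} {y} cx cy ε 0<ε
      with cx (ε ℚ.* ½) (*-pos 0<ε 0<½) | cy (ε ℚ.* ½) (*-pos 0<ε 0<½)
    ... | N , hx | M , hy = N ⊔ M , λ m n N≤m N≤n →
      let open ℚ.≤-Reasoning in begin-strict
      ∣ (x m ℚ.+ y m) ℚ.- (x n ℚ.+ y n) ∣
        ≡⟨ cong ∣_∣ (regroup (x m) (y m) (x n) (y n)) ⟩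
      ∣ (x m ℚ.- x n) ℚ.+ (y m ℚ.- y n) ∣
        ≤⟨ ℚ.∣p+q∣≤∣p∣+∣q∣ (x m ℚ.- x n) (y m ℚ.- y n) ⟩
      ∣ x m ℚ.- x n ∣ ℚ.+ ∣ y m ℚ.- y n ∣
        <⟨ ℚ.+-mono-< (hx m n (ℕ.m⊔n≤o⇒m≤o N M N≤m) (ℕ.m⊔n≤o⇒m≤o N M N≤n))
                      (hy m n (ℕ.m⊔n≤o⇒n≤o N M N≤m) (ℕ.m⊔n≤o⇒n≤o N M N≤n)) ⟩
      ε ℚ.* ½ ℚ.+ ε ℚ.* ½
        ≡⟨ trans (sym (ℚ.*-distribˡ-+ ε ½ ½)) (ℚ.*-identityʳ ε) ⟩
      ε ∎
      where
      regroup : ∀ a b c d →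
        (a ℚ.+ b) ℚ.- (c ℚ.+ d) ≡ (a ℚ.- c) ℚ.+ (b ℚ.- d)
      regroup a b c d = trans (cong ((a ℚ.+ b) ℚ.+_) (ℚ.neg-distrib-+ c d))
        (interchange a b (ℚ.- c) (ℚ.- d))

    bounded : ∀ {x} → Cauchy x →
      ∃[ B ] ∃[ N ] (0ℚ ℚ.< B × (∀ n → N ℕ.≤ n → ∣ x n ∣ ℚ.≤ B))
    bounded {x} cx with cx 1ℚ (ℚ.positive⁻¹ 1ℚ)
    ... | N , h = 1ℚ ℚ.+ ∣ x N ∣ , N
      , ℚ.positive⁻¹ _ {{ℚ.pos+nonNeg⇒pos 1ℚ ∣ x N ∣ {{ℚ.∣-∣-nonNeg (x N)}}}}
      , λ n N≤n → let open ℚ.≤-Reasoning in begin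
      ∣ x n ∣
        ≡⟨ cong ∣_∣ (regroup (x n) (x N)) ⟩
      ∣ (x n ℚ.- x N) ℚ.+ x N ∣
        ≤⟨ ℚ.∣p+q∣≤∣p∣+∣q∣ (x n ℚ.- x N) (x N) ⟩
      ∣ x n ℚ.- x N ∣ ℚ.+ ∣ x N ∣
        ≤⟨ ℚ.+-monoˡ-≤ ∣ x N ∣ (ℚ.<⇒≤ (h n N N≤n ℕ.≤-refl)) ⟩
      1ℚ ℚ.+ ∣ x N ∣ ∎
      where
      regroup : ∀ a b → a ≡ (a ℚ.- b) ℚ.+ b
      regroup a b = sym (trans (ℚ.+-assoc a (ℚ.- b) b)
        (trans (cong (a ℚ.+_) (ℚ.+-inverseˡ b)) (ℚ.+-identityʳ a)))

    *-bound : ∀ {a b B δ} → 0ℚ ℚ.< B → ∣ a ∣ ℚ.≤ B → ∣ b ∣ ℚ.< δ →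
      ∣ a ℚ.* b ∣ ℚ.< B ℚ.* δ
    *-bound {a} {b} {B} {δ} 0<B a≤B b<δ = let open ℚ.≤-Reasoning in begin-strict
      ∣ a ℚ.* b ∣      ≡⟨ ℚ.∣p*q∣≡∣p∣*∣q∣ a b ⟩
      ∣ a ∣ ℚ.* ∣ b ∣  ≤⟨ ℚ.*-monoʳ-≤-nonNeg ∣ b ∣ {{ℚ.∣-∣-nonNeg b}} a≤B ⟩
      B ℚ.* ∣ b ∣      <⟨ ℚ.*-monoʳ-<-pos B {{ℚ.positive 0<B}} b<δ ⟩
      B ℚ.* δ ∎

    divide : ∀ {K ε} → 0ℚ ℚ.< K → 0ℚ ℚ.< ε →
      ∃[ δ ] (0ℚ ℚ.< δ × K ℚ.* δ ≡ ε)
    divide {K} {ε} 0<K 0<ε = K⁻¹ ℚ.* ε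
      , *-pos (ℚ.positive⁻¹ K⁻¹ {{ℚ.1/pos⇒pos K {{ℚ.positive 0<K}}}}) 0<ε
      , trans (sym (ℚ.*-assoc K K⁻¹ ε))
          (trans (cong (ℚ._* ε) (ℚ.*-inverseʳ K {{K≢0}})) (ℚ.*-identityˡ ε))
      where
      K≢0 : ℚ.NonZero K
      K≢0 = ℚ.pos⇒nonZero K {{ℚ.positive 0<K}}
      K⁻¹ : ℚ
      K⁻¹ = (ℚ.1/ K) {{K≢0}}

    *-close : ∀ a b c d {A B δ} → 0ℚ ℚ.< A → 0ℚ ℚ.< B → ∣ a ∣ ℚ.≤ A → ∣ d ∣ ℚ.≤ B →
      ∣ a ℚ.- c ∣ ℚ.< δ → ∣ b ℚ.- d ∣ ℚ.< δ →
      ∣ a ℚ.* b ℚ.- c ℚ.* d ∣ ℚ.< (A ℚ.+ B) ℚ.* δ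
    *-close a b c d {A} {B} {δ} 0<A 0<B a≤A d≤B ac bd = let open ℚ.≤-Reasoning in begin-strict
      ∣ a ℚ.* b ℚ.- c ℚ.* d ∣
        ≡⟨ cong ∣_∣ (regroup a b c d) ⟩
      ∣ a ℚ.* (b ℚ.- d) ℚ.+ d ℚ.* (a ℚ.- c) ∣
        ≤⟨ ℚ.∣p+q∣≤∣p∣+∣q∣ (a ℚ.* (b ℚ.- d)) (d ℚ.* (a ℚ.- c)) ⟩
      ∣ a ℚ.* (b ℚ.- d) ∣ ℚ.+ ∣ d ℚ.* (a ℚ.- c) ∣
        <⟨ ℚ.+-mono-< (*-bound {a} {b ℚ.- d} 0<A a≤A bd) (*-bound {d} {a ℚ.- c} 0<B d≤B ac) ⟩
      A ℚ.* δ ℚ.+ B ℚ.* δ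
        ≡⟨ ℚ.*-distribʳ-+ δ A B ⟨
      (A ℚ.+ B) ℚ.* δ ∎
      where
      regroup : ∀ a b c d →
        a ℚ.* b ℚ.- c ℚ.* d ≡ a ℚ.* (b ℚ.- d) ℚ.+ d ℚ.* (a ℚ.- c)
      regroup a b c d = sym (let open ≡-Reasoning in begin
        a ℚ.* (b ℚ.- d) ℚ.+ d ℚ.* (a ℚ.- c)
          ≡⟨ cong₂ ℚ._+_ (ℚ.*-distribˡ-+ a b (ℚ.- d)) (ℚ.*-distribˡ-+ d a (ℚ.- c)) ⟩
        (a ℚ.* b ℚ.+ a ℚ.* ℚ.- d) ℚ.+ (d ℚ.* a ℚ.+ d ℚ.* ℚ.- c)
          ≡⟨ interchange (a ℚ.* b) (a ℚ.* ℚ.- d) (d ℚ.* a) (d ℚ.* ℚ.- c) ⟩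
        (a ℚ.* b ℚ.+ d ℚ.* a) ℚ.+ (a ℚ.* ℚ.- d ℚ.+ d ℚ.* ℚ.- c)
          ≡⟨ ℚ.+-assoc (a ℚ.* b) (d ℚ.* a) (a ℚ.* ℚ.- d ℚ.+ d ℚ.* ℚ.- c) ⟩
        a ℚ.* b ℚ.+ (d ℚ.* a ℚ.+ (a ℚ.* ℚ.- d ℚ.+ d ℚ.* ℚ.- c))
          ≡⟨ cong (a ℚ.* b ℚ.+_) (ℚ.+-assoc (d ℚ.* a) (a ℚ.* ℚ.- d) (d ℚ.* ℚ.- c)) ⟨
        a ℚ.* b ℚ.+ ((d ℚ.* a ℚ.+ a ℚ.* ℚ.- d) ℚ.+ d ℚ.* ℚ.- c)
          ≡⟨ cong (λ r → a ℚ.* b ℚ.+ (r ℚ.+ d ℚ.* ℚ.- c)) cancel ⟩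
        a ℚ.* b ℚ.+ (0ℚ ℚ.+ d ℚ.* ℚ.- c)
          ≡⟨ cong (a ℚ.* b ℚ.+_) (ℚ.+-identityˡ (d ℚ.* ℚ.- c)) ⟩
        a ℚ.* b ℚ.+ d ℚ.* ℚ.- c
          ≡⟨ cong (a ℚ.* b ℚ.+_) (trans (sym (ℚ.neg-distribʳ-* d c)) (cong ℚ.-_ (ℚ.*-comm d c))) ⟩
        a ℚ.* b ℚ.- c ℚ.* d ∎)
        where
        cancel : d ℚ.* a ℚ.+ a ℚ.* ℚ.- d ≡ 0ℚ
        cancel = trans (cong₂ ℚ._+_ (ℚ.*-comm d a) (sym (ℚ.neg-distribʳ-* a d)))
          (ℚ.+-inverseʳ (a ℚ.* d))

    *-cauchy : ∀ {x y} → Cauchy x → Cauchy y → Cauchy (λ n → x n ℚ.* y n)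
    *-cauchy {x} {y} cx cy ε 0<ε =
      let
        A , N₁ , 0<A , x≤A = bounded {x} cx
        B , N₂ , 0<B , y≤B = bounded {y} cy
        δ , 0<δ , eq = divide {A ℚ.+ B} {ε} (ℚ.+-mono-< 0<A 0<B) 0<ε
        N₃ , hx = cx δ 0<δ
        N₄ , hy = cy δ 0<δ
        low : ∀ k → N₁ ⊔ N₂ ⊔ (N₃ ⊔ N₄) ℕ.≤ k → N₁ ⊔ N₂ ℕ.≤ k
        low k = ℕ.m⊔n≤o⇒m≤o (N₁ ⊔ N₂) (N₃ ⊔ N₄)
        high : ∀ k → N₁ ⊔ N₂ ⊔ (N₃ ⊔ N₄) ℕ.≤ k → N₃ ⊔ N₄ ℕ.≤ k
        high k = ℕ.m⊔n≤o⇒n≤o (N₁ ⊔ N₂) (N₃ ⊔ N₄)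
      in N₁ ⊔ N₂ ⊔ (N₃ ⊔ N₄) , λ m n N≤m N≤n →
        subst (∣ x m ℚ.* y m ℚ.- x n ℚ.* y n ∣ ℚ.<_) eq
          (*-close (x m) (y m) (x n) (y n) 0<A 0<B
            (x≤A m (ℕ.m⊔n≤o⇒m≤o N₁ N₂ (low m N≤m)))
            (y≤B n (ℕ.m⊔n≤o⇒n≤o N₁ N₂ (low n N≤n)))
            (hx m n (ℕ.m⊔n≤o⇒m≤o N₃ N₄ (high m N≤m)) (ℕ.m⊔n≤o⇒m≤o N₃ N₄ (high n N≤n)))
            (hy m n (ℕ.m⊔n≤o⇒n≤o N₃ N₄ (high m N≤m)) (ℕ.m⊔n≤o⇒n≤o N₃ N₄ (high n N≤n))))

fromℚ : ℚ → ℝ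
fromℚ q = mkℝ (λ _ → q) (const-cauchy q)

fromℤ : ℤ → ℝ
fromℤ z = fromℚ (z ℚ./ 1)

0ℝ : ℝ
0ℝ = fromℚ 0ℚ

_+_ : ℝ → ℝ → ℝ
x + y = mkℝ (λ n → seq x n ℚ.+ seq y n) (+-cauchy {seq x} {seq y} (cauchy x) (cauchy y))

_*_ : ℝ → ℝ → ℝ
x * y = mkℝ (λ n → seq x n ℚ.* seq y n) (*-cauchy {seq x} {seq y} (cauchy x) (cauchy y))

∑ : ∀ {k} → (Fin k → ℝ) → ℝ
∑ = foldr _+_ 0ℝ

-- Pairs (i , j) with 1 ≤ i ≤ j ≤ Δ.  The Fin components are zero-based:
-- j = toℕ upper + 1 ranges over 1 … Δ and i = toℕ lower + 1 over 1 … j.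
record DegreePair (Δ : ℕ) : Set where
  constructor ⟨_,_⟩
  field
    upper : Fin Δ
    lower : Fin (suc (toℕ upper))

  i j : ℕ
  i = suc (toℕ lower)
  j = suc (toℕ upper)

open DegreePair using (upper; i; j)

∑ₚ : ∀ {Δ} → (DegreePair Δ → ℝ) → ℝ
∑ₚ f = ∑ λ u → ∑ λ l → f ⟨ u , l ⟩

Assignment : ℕ → Set
Assignment Δ = DegreePair Δ → ℝ

cost : ∀ {Δ} → DegreePair Δ → ℝ
cost p = fromℤ ((+ i p ℤ.- + j p) ℤ.^ 2)

weight : ∀ {Δ} → DegreePair Δ → ℝ
weight p = fromℚ (+ 1 ℚ./ i p ℚ.+ + 1 ℚ./ j p)

objective : ∀ {Δ} → Assignment Δ → ℝ
objective m = ∑ₚ λ p → cost p * m p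

record Feasible (Δ n : ℕ) (m : Assignment Δ) : Set where
  field
    order  : ∑ₚ (λ p → weight p * m p) ≃ fromℤ (+ n)
    size   : ∑ₚ m ≃ fromℤ (+ n ℤ.- + 1)
    nonneg : ∀ p → 0ℝ ≤ m p

record Optimal (Δ n : ℕ) (m : Assignment Δ) : Set where
  field
    feasible : Feasible Δ n m
    maximal  : ∀ m′ → Feasible Δ n m′ → objective m′ ≤ objective m

solution : ∀ Δ → ℕ → Assignment Δ
solution Δ n p =
  if      p is 1 , Δ then fromℚ (((+ Δ ℤ.- + 2) ℤ.* + n ℤ.+ (+ Δ ℤ.+ + 2)) ℚ./ Δ)
  else if p is 2 , Δ then fromℚ ((+ 2 ℤ.* (+ n ℤ.- + Δ ℤ.- + 1)) ℚ./ Δ)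
  else    0ℝ
  where
  instance
    Δ≢0 : ℕ.NonZero Δ
    Δ≢0 = nonZeroIndex (upper p)
  _is_,_ : DegreePair Δ → ℕ → ℕ → Bool
  q is a , b = ⌊ i q ℕ.≟ a ⌋ ∧ ⌊ j q ℕ.≟ b ⌋

{-# OPTIONS --safe #-}
module Submission where

-- Linear programming duality.  Price the order constraint at a = 4Δ − 6 and the size
-- constraint at b = (Δ − 1)² − a (1 + 1/Δ), the values that make the dual constraints of
-- (1 , Δ) and (2 , Δ) tight.  The dual slack of (i , j) then factors as
--   a (1/i + 1/j) + b − (i − j)²
--     = (i − 1)(i − 2)(2Δ − 3 − i)/i + (Δ − j)(a/(jΔ) + (Δ − i) + (j − i)),
-- which is nonnegative, and positive at every other pair.  Hence an optimal assignment
-- vanishes off the two tight pairs, where the two equality constraints determine it.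

open import Defs
open import Algebra.Bundles using (CommutativeRing)
import Algebra.Properties.Semiring.Sum as Sum
open import Data.Bool using (true; false)
open import Data.Fin using (Fin; zero; suc; toℕ; fromℕ)
import Data.Fin.Properties as Fin
open import Data.Integer as ℤ using (ℤ; +_)
import Data.Integer.Properties as ℤ
open import Data.Nat as ℕ using (ℕ; suc; _⊔_; s≤s; z≤n)
import Data.Nat.Properties as ℕ
open import Data.Product using (_×_; _,_; proj₁; proj₂; ∃-syntax)
open import Data.Rational as ℚ using (ℚ; 0ℚ; 1ℚ; ½; ∣_∣)
import Data.Rational.Properties as ℚ
open import Data.Rational.Solver using (module +-*-Solver)
open import Data.Rational.Unnormalised as ℚᵘ using (mkℚᵘ; *≡*)
import Data.Rational.Unnormalised.Properties as ℚᵘ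
open import Data.Sum using (_⊎_; inj₁; inj₂; [_,_]′)
open import Function using (_∘_)
open import Relation.Binary.PropositionalEquality using (_≡_; _≢_; refl; sym; trans; cong; cong₂; subst; module ≡-Reasoning)
open import Relation.Nullary using (¬_; Dec; yes; no; contradiction)
open import Relation.Nullary.Decidable using (⌊_⌋)

open +-*-Solver using (solve; con; _:=_; _:+_; _:*_; _:-_; :-_)
open Sum (CommutativeRing.semiring ℚ.+-*-commutativeRing)
  using (sum; sum-cong-≗; *-distribˡ-sum)
open DegreePair using (i; j)

-- Limits superior and null sequences of rationals.

-- Equality and order of reals are statements about limits superior of rational sequences;
-- the sequences with nonpositive limit superior form a convex cone.
LimSup≤0 : (ℕ → ℚ) → Set
LimSup≤0 f = ∀ ε → 0ℚ ℚ.< ε → ∃[ N ] (∀ n → N ℕ.≤ n → f n ℚ.< ε)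

-- Convergence to zero is split into two one-sided conditions, so that facts about null sequences
-- follow from the cone operations applied twice.
Null : (ℕ → ℚ) → Set
Null f = LimSup≤0 f × LimSup≤0 (λ n → ℚ.- f n)

private variable f g : ℕ → ℚ

*-pos : ∀ {p q} → 0ℚ ℚ.< p → 0ℚ ℚ.< q → 0ℚ ℚ.< p ℚ.* q
*-pos {p} {q} 0<p 0<q = ℚ.positive⁻¹ (p ℚ.* q)
  {{ℚ.pos*pos⇒pos p {{ℚ.positive 0<p}} q {{ℚ.positive 0<q}}}}

*-nonNeg : ∀ {p q} → 0ℚ ℚ.≤ p → 0ℚ ℚ.≤ q → 0ℚ ℚ.≤ p ℚ.* q
*-nonNeg {p} {q} 0≤p 0≤q = ℚ.nonNegative⁻¹ (p ℚ.* q)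
  {{ℚ.nonNeg*nonNeg⇒nonNeg p {{ℚ.nonNegative 0≤p}} q {{ℚ.nonNegative 0≤q}}}}

limSup-resp : (∀ n → f n ≡ g n) → LimSup≤0 f → LimSup≤0 g
limSup-resp f≡g L ε 0<ε with L ε 0<ε
... | N , h = N , λ n N≤n → subst (ℚ._< ε) (f≡g n) (h n N≤n)

limSup-nonPos : (∀ n → f n ℚ.≤ 0ℚ) → LimSup≤0 f
limSup-nonPos f≤0 ε 0<ε = 0 , λ n _ → ℚ.≤-<-trans (f≤0 n) 0<ε

limSup-+ : LimSup≤0 f → LimSup≤0 g → LimSup≤0 (λ n → f n ℚ.+ g n)
limSup-+ {f} {g} Lf Lg ε 0<ε
  with Lf (½ ℚ.* ε) (*-pos (ℚ.positive⁻¹ ½) 0<ε) | Lg (½ ℚ.* ε) (*-pos (ℚ.positive⁻¹ ½) 0<ε)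
... | N , hf | M , hg = N ⊔ M , λ n le →
  subst (f n ℚ.+ g n ℚ.<_) (solve 1 (λ e → con ½ :* e :+ con ½ :* e := e) refl ε)
    (ℚ.+-mono-< (hf n (ℕ.m⊔n≤o⇒m≤o N M le)) (hg n (ℕ.m⊔n≤o⇒n≤o N M le)))

limSup-pos* : ∀ c → 0ℚ ℚ.< c → LimSup≤0 f → LimSup≤0 (λ n → c ℚ.* f n)
limSup-pos* {f} c 0<c L ε 0<ε =
  let N , h = L (c⁻¹ ℚ.* ε) (*-pos (ℚ.positive⁻¹ c⁻¹ {{ℚ.1/pos⇒pos c}}) 0<ε)
  in N , λ n N≤n → subst (c ℚ.* f n ℚ.<_) eq (ℚ.*-monoʳ-<-pos c (h n N≤n))
  where
  instance
    c-pos : ℚ.Positive c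
    c-pos = ℚ.positive 0<c
    c≢0 : ℚ.NonZero c
    c≢0 = ℚ.pos⇒nonZero c
  c⁻¹ : ℚ
  c⁻¹ = ℚ.1/ c
  eq : c ℚ.* (c⁻¹ ℚ.* ε) ≡ ε
  eq = trans (sym (ℚ.*-assoc c c⁻¹ ε))
    (trans (cong (ℚ._* ε) (ℚ.*-inverseʳ c)) (ℚ.*-identityˡ ε))

limSup-* : ∀ c → 0ℚ ℚ.≤ c → LimSup≤0 f → LimSup≤0 (λ n → c ℚ.* f n)
limSup-* {f} c 0≤c L with 0ℚ ℚ.<? c
... | yes 0<c = limSup-pos* c 0<c L
-- Here c = 0: rescaling `ε` by the inverse of c is impossible, but the product is constantly 0.
... | no 0≮c rewrite ℚ.≤-antisym (ℚ.≮⇒≥ 0≮c) 0≤c =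
  limSup-nonPos λ n → ℚ.≤-reflexive (ℚ.*-zeroˡ (f n))

limSup-pos*⁻¹ : ∀ c → 0ℚ ℚ.< c → LimSup≤0 (λ n → c ℚ.* f n) → LimSup≤0 f
limSup-pos*⁻¹ c 0<c L ε 0<ε with L (c ℚ.* ε) (*-pos 0<c 0<ε)
... | N , h = N , λ n N≤n →
  ℚ.*-cancelˡ-<-nonNeg c {{ℚ.nonNegative (ℚ.<⇒≤ 0<c)}} (h n N≤n)

null-resp : (∀ n → f n ≡ g n) → Null f → Null g
null-resp f≡g (u , v) = limSup-resp f≡g u , limSup-resp (cong ℚ.-_ ∘ f≡g) v

null-0 : (∀ n → f n ≡ 0ℚ) → Null f
null-0 f≡0 = limSup-nonPos (ℚ.≤-reflexive ∘ f≡0)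
           , limSup-nonPos (λ n → ℚ.≤-reflexive (cong ℚ.-_ (f≡0 n)))

null-neg : Null f → Null (λ n → ℚ.- f n)
null-neg {f} (u , v) = v , limSup-resp (λ n → solve 1 (λ x → x := :- (:- x)) refl (f n)) u

null-+ : Null f → Null g → Null (λ n → f n ℚ.+ g n)
null-+ {f} {g} (u , v) (u′ , v′) =
  limSup-+ u u′ , limSup-resp (λ n → sym (ℚ.neg-distrib-+ (f n) (g n))) (limSup-+ v v′)

null-* : ∀ c → Null f → Null (λ n → c ℚ.* f n)
null-* {f} c (u , v) with ℚ.≤-total 0ℚ c
... | inj₁ 0≤c = limSup-* c 0≤c u
               , limSup-resp (λ n → sym (ℚ.neg-distribʳ-* c (f n))) (limSup-* c 0≤c v)
... | inj₂ c≤0 =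
    limSup-resp (λ n → solve 2 (λ c x → (:- c) :* (:- x) := c :* x) refl c (f n))
      (limSup-* (ℚ.- c) (ℚ.neg-antimono-≤ c≤0) v)
  , limSup-resp (λ n → sym (ℚ.neg-distribˡ-* c (f n)))
      (limSup-* (ℚ.- c) (ℚ.neg-antimono-≤ c≤0) u)

-- Finite sums of sequences and sums over degree pairs.

limSup-sum : ∀ {k} {f : ℕ → Fin k → ℚ} →
  (∀ i → LimSup≤0 (λ n → f n i)) → LimSup≤0 (λ n → sum (f n))
limSup-sum {ℕ.zero}  L = limSup-nonPos λ _ → ℚ.≤-refl
limSup-sum {suc k} L = limSup-+ (L zero) (limSup-sum (L ∘ suc))

neg-sum : ∀ {k} (f : Fin k → ℚ) → sum (λ i → ℚ.- f i) ≡ ℚ.- sum f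
neg-sum {ℕ.zero}  f = refl
neg-sum {suc k} f = trans (cong (ℚ.- f zero ℚ.+_) (neg-sum (f ∘ suc)))
  (sym (ℚ.neg-distrib-+ (f zero) _))

sum-− : ∀ {k} (f g : Fin k → ℚ) → sum (λ i → f i ℚ.- g i) ≡ sum f ℚ.- sum g
sum-− {ℕ.zero}  f g = refl
sum-− {suc k} f g = trans (cong (f zero ℚ.- g zero ℚ.+_) (sum-− (f ∘ suc) (g ∘ suc)))
  (solve 4 (λ a b c d → (a :- b) :+ (c :- d) := (a :+ c) :- (b :+ d)) refl
    (f zero) (g zero) (sum (f ∘ suc)) (sum (g ∘ suc)))

sum-0 : ∀ {k} (f : Fin k → ℚ) → (∀ i → f i ≡ 0ℚ) → sum f ≡ 0ℚ
sum-0 {ℕ.zero}  f h = refl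
sum-0 {suc k} f h = cong₂ ℚ._+_ (h zero) (sum-0 (f ∘ suc) (h ∘ suc))

sum-single : ∀ {k} (f : Fin k → ℚ) i → (∀ i′ → i′ ≢ i → f i′ ≡ 0ℚ) → sum f ≡ f i
sum-single {suc k} f zero h =
  trans (cong (f zero ℚ.+_) (sum-0 (f ∘ suc) λ i → h (suc i) λ ())) (ℚ.+-identityʳ (f zero))
sum-single {suc k} f (suc i) h =
  trans (cong₂ ℚ._+_ (h zero λ ()) (sum-single (f ∘ suc) i λ i′ ne → h (suc i′) (ne ∘ Fin.suc-injective)))
    (ℚ.+-identityˡ (f (suc i)))

-- Adding the negatives of the other terms to the total leaves the chosen term. Hence an upper bound
-- on the total and lower bounds on the other terms suffice, which is all that optimality will
-- provide.
limSup-summand : ∀ {k} {f : ℕ → Fin k → ℚ} i → LimSup≤0 (λ n → sum (f n)) →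
  (∀ i′ → i′ ≢ i → LimSup≤0 (λ n → ℚ.- f n i′)) → LimSup≤0 (λ n → f n i)
limSup-summand {suc k} {f} zero L h =
  limSup-resp (λ n → trans (cong (sum (f n) ℚ.+_) (neg-sum (f n ∘ suc)))
      (solve 2 (λ a b → (a :+ b) :+ (:- b) := a) refl (f n zero) (sum (f n ∘ suc))))
    (limSup-+ L (limSup-sum λ i → h (suc i) λ ()))
limSup-summand {suc k} {f} (suc i) L h = limSup-summand i
  (limSup-resp (λ n → solve 2 (λ a b → (a :+ b) :+ (:- a) := b) refl (f n zero) (sum (f n ∘ suc)))
    (limSup-+ L (h zero λ ())))
  λ i′ ne → h (suc i′) (ne ∘ Fin.suc-injective)

sumₚ : ∀ {Δ} → (DegreePair Δ → ℚ) → ℚ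
sumₚ f = sum λ u → sum λ l → f ⟨ u , l ⟩

seq-∑ₚ : ∀ {Δ} (f : DegreePair Δ → ℝ) k → seq (∑ₚ f) k ≡ sumₚ (λ p → seq (f p) k)
seq-∑ₚ f k = trans (seq-∑ (λ u → ∑ λ l → f ⟨ u , l ⟩) k)
  (sum-cong-≗ λ u → seq-∑ (λ l → f ⟨ u , l ⟩) k)
  where
  seq-∑ : ∀ {r} (f : Fin r → ℝ) k → seq (∑ f) k ≡ sum (λ i → seq (f i) k)
  seq-∑ {ℕ.zero}  f k = refl
  seq-∑ {suc r} f k = cong (seq (f zero) k ℚ.+_) (seq-∑ (f ∘ suc) k)

sumₚ-cong : ∀ {Δ} {f g : DegreePair Δ → ℚ} → (∀ p → f p ≡ g p) → sumₚ f ≡ sumₚ g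
sumₚ-cong h = sum-cong-≗ λ u → sum-cong-≗ λ l → h ⟨ u , l ⟩

sumₚ-− : ∀ {Δ} (f g : DegreePair Δ → ℚ) → sumₚ (λ p → f p ℚ.- g p) ≡ sumₚ f ℚ.- sumₚ g
sumₚ-− f g = trans
  (sum-cong-≗ λ u → sum-− (λ l → f ⟨ u , l ⟩) (λ l → g ⟨ u , l ⟩))
  (sum-− (λ u → sum λ l → f ⟨ u , l ⟩) (λ u → sum λ l → g ⟨ u , l ⟩))

sumₚ-* : ∀ {Δ} c (f : DegreePair Δ → ℚ) → sumₚ (λ p → c ℚ.* f p) ≡ c ℚ.* sumₚ f
sumₚ-* c f = sym (trans (*-distribˡ-sum c (λ u → sum λ l → f ⟨ u , l ⟩))
  (sum-cong-≗ λ u → *-distribˡ-sum c (λ l → f ⟨ u , l ⟩)))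

limSup-sumₚ : ∀ {Δ} {f : ℕ → DegreePair Δ → ℚ} →
  (∀ p → LimSup≤0 (λ n → f n p)) → LimSup≤0 (λ n → sumₚ (f n))
limSup-sumₚ L = limSup-sum λ u → limSup-sum λ l → L ⟨ u , l ⟩

limSup-summandₚ : ∀ {Δ} {f : ℕ → DegreePair Δ → ℚ} p → LimSup≤0 (λ n → sumₚ (f n)) →
  (∀ q → q ≢ p → LimSup≤0 (λ n → ℚ.- f n q)) → LimSup≤0 (λ n → f n p)
limSup-summandₚ {f = f} ⟨ u , l ⟩ L h = limSup-summand l
  (limSup-summand u L λ u′ ne →
    limSup-resp (λ n → neg-sum (λ l′ → f n ⟨ u′ , l′ ⟩))
      (limSup-sum λ l′ → h ⟨ u′ , l′ ⟩ (ne ∘ cong DegreePair.upper)))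
  λ l′ ne → h ⟨ u , l′ ⟩ λ { refl → ne refl }

neg-sumₚ : ∀ {Δ} (f : DegreePair Δ → ℚ) → sumₚ (λ p → ℚ.- f p) ≡ ℚ.- sumₚ f
neg-sumₚ f = trans (sum-cong-≗ λ u → neg-sum (λ l → f ⟨ u , l ⟩))
  (neg-sum (λ u → sum λ l → f ⟨ u , l ⟩))

null-summandₚ : ∀ {Δ} {f : ℕ → DegreePair Δ → ℚ} p → Null (λ n → sumₚ (f n)) →
  (∀ q → q ≢ p → Null (λ n → f n q)) → Null (λ n → f n p)
null-summandₚ {f = f} p (u , v) h =
    limSup-summandₚ p u (λ q q≢p → proj₂ (h q q≢p))
  , limSup-summandₚ p (limSup-resp (λ n → sym (neg-sumₚ (f n))) v)
      (λ q q≢p → proj₂ (null-neg (h q q≢p)))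

-- Relations between reals as limits superior of differences.

≤⇒limSup : ∀ x y → x ≤ y → LimSup≤0 (λ n → seq x n ℚ.- seq y n)
≤⇒limSup x y x≤y ε 0<ε with x≤y ε 0<ε
... | N , h = N , λ n N≤n → subst (seq x n ℚ.- seq y n ℚ.<_)
  (solve 2 (λ y e → (y :+ e) :- y := e) refl (seq y n) ε) (ℚ.+-monoˡ-< (ℚ.- seq y n) (h n N≤n))

limSup⇒≤ : ∀ x y → LimSup≤0 (λ n → seq x n ℚ.- seq y n) → x ≤ y
limSup⇒≤ x y L ε 0<ε with L ε 0<ε
... | N , h = N , λ n N≤n → subst (ℚ._< seq y n ℚ.+ ε)
  (solve 2 (λ x y → y :+ (x :- y) := x) refl (seq x n) (seq y n)) (ℚ.+-monoʳ-< (seq y n) (h n N≤n))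

≃⇒null : ∀ x y → x ≃ y → Null (λ n → seq x n ℚ.- seq y n)
≃⇒null x y x≃y = half _ (λ n → ℚ.≤-refl)
               , half _ (λ n → ℚ.≤-reflexive (ℚ.∣-p∣≡∣p∣ (seq x n ℚ.- seq y n)))
  where
  p≤∣p∣ : ∀ p → p ℚ.≤ ∣ p ∣
  p≤∣p∣ p with ℚ.≤-total 0ℚ p
  ... | inj₁ 0≤p = ℚ.≤-reflexive (sym (ℚ.0≤p⇒∣p∣≡p 0≤p))
  ... | inj₂ p≤0 = ℚ.≤-trans p≤0 (ℚ.0≤∣p∣ p)
  -- Serves for the difference and for its negative, which share one absolute value.
  half : ∀ f → (∀ n → ∣ f n ∣ ℚ.≤ ∣ seq x n ℚ.- seq y n ∣) → LimSup≤0 f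
  half f b ε 0<ε with x≃y ε 0<ε
  ... | N , h = N , λ n N≤n → ℚ.≤-<-trans (ℚ.≤-trans (p≤∣p∣ (f n)) (b n)) (h n N≤n)

null⇒≃ : ∀ x y → Null (λ n → seq x n ℚ.- seq y n) → x ≃ y
null⇒≃ x y (u , v) ε 0<ε with u ε 0<ε | v ε 0<ε
... | N , h | M , h′ = N ⊔ M , λ n le →
  bound (seq x n ℚ.- seq y n) (h n (ℕ.m⊔n≤o⇒m≤o N M le)) (h′ n (ℕ.m⊔n≤o⇒n≤o N M le))
  where
  bound : ∀ p → p ℚ.< ε → ℚ.- p ℚ.< ε → ∣ p ∣ ℚ.< ε
  bound p lt lt′ with ℚ.∣p∣≡p∨∣p∣≡-p p
  ... | inj₁ eq = subst (ℚ._< ε) (sym eq) lt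
  ... | inj₂ eq = subst (ℚ._< ε) (sym eq) lt′

-- Integers and reciprocals inside the rationals.

-- Forming `z / d` cancels a gcd, so identities of fractions are checked on unnormalised ones and
-- carried over by this homomorphism.
fromℚᵘ-homo-+ : ∀ p q → ℚ.fromℚᵘ (p ℚᵘ.+ q) ≡ ℚ.fromℚᵘ p ℚ.+ ℚ.fromℚᵘ q
fromℚᵘ-homo-+ p q = ℚ.toℚᵘ-injective (ℚᵘ.≃-trans (ℚ.toℚᵘ-fromℚᵘ (p ℚᵘ.+ q))
  (ℚᵘ.≃-sym (ℚᵘ.≃-trans (ℚ.toℚᵘ-homo-+ (ℚ.fromℚᵘ p) (ℚ.fromℚᵘ q))
    (ℚᵘ.+-cong (ℚ.toℚᵘ-fromℚᵘ p) (ℚ.toℚᵘ-fromℚᵘ q)))))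

fromℚᵘ-homo-* : ∀ p q → ℚ.fromℚᵘ (p ℚᵘ.* q) ≡ ℚ.fromℚᵘ p ℚ.* ℚ.fromℚᵘ q
fromℚᵘ-homo-* p q = ℚ.toℚᵘ-injective (ℚᵘ.≃-trans (ℚ.toℚᵘ-fromℚᵘ (p ℚᵘ.* q))
  (ℚᵘ.≃-sym (ℚᵘ.≃-trans (ℚ.toℚᵘ-homo-* (ℚ.fromℚᵘ p) (ℚ.fromℚᵘ q))
    (ℚᵘ.*-cong (ℚ.toℚᵘ-fromℚᵘ p) (ℚ.toℚᵘ-fromℚᵘ q)))))

⟦_⟧ : ℤ → ℚ
⟦ z ⟧ = z ℚ./ 1

ι : ℕ → ℚ
ι k = ⟦ + k ⟧

⟦⟧-+ : ∀ x y → ⟦ x ℤ.+ y ⟧ ≡ ⟦ x ⟧ ℚ.+ ⟦ y ⟧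
-- The factors 1 appear in the numerator of the unnormalised sum x/1 + y/1.
⟦⟧-+ x y = trans (cong ⟦_⟧ (sym (cong₂ ℤ._+_ (ℤ.*-identityʳ x) (ℤ.*-identityʳ y))))
  (fromℚᵘ-homo-+ (mkℚᵘ x 0) (mkℚᵘ y 0))

⟦⟧-* : ∀ x y → ⟦ x ℤ.* y ⟧ ≡ ⟦ x ⟧ ℚ.* ⟦ y ⟧
⟦⟧-* x y = fromℚᵘ-homo-* (mkℚᵘ x 0) (mkℚᵘ y 0)

⟦⟧-− : ∀ x y → ⟦ x ℤ.- y ⟧ ≡ ⟦ x ⟧ ℚ.- ⟦ y ⟧
⟦⟧-− x y = trans (solve 2 (λ a b → a := (a :+ b) :- b) refl ⟦ x ℤ.- y ⟧ ⟦ y ⟧)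
  (cong (ℚ._- ⟦ y ⟧) (trans (sym (⟦⟧-+ (x ℤ.- y) y)) (cong ⟦_⟧ x-y+y≡x)))
  where
  x-y+y≡x : x ℤ.- y ℤ.+ y ≡ x
  x-y+y≡x = trans (ℤ.+-assoc x (ℤ.- y) y)
    (trans (cong (λ t → x ℤ.+ t) (ℤ.+-inverseˡ y)) (ℤ.+-identityʳ x))

recip : ∀ d → .{{ℕ.NonZero d}} → ℚ
recip d = + 1 ℚ./ d

/≡*recip : ∀ z d .{{_ : ℕ.NonZero d}} → z ℚ./ d ≡ ⟦ z ⟧ ℚ.* recip d
/≡*recip z (suc d) = trans
  (ℚ.fromℚᵘ-cong {mkℚᵘ z d} {mkℚᵘ z 0 ℚᵘ.* mkℚᵘ (+ 1) d} (*≡* (cong₂ ℤ._*_ (sym (ℤ.*-identityʳ z))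
    (cong (λ t → + suc t) (ℕ.+-identityʳ d)))))
  (fromℚᵘ-homo-* (mkℚᵘ z 0) (mkℚᵘ (+ 1) d))

ι*recip : ∀ d .{{_ : ℕ.NonZero d}} → ι d ℚ.* recip d ≡ 1ℚ
ι*recip (suc d) = trans (sym (/≡*recip (+ suc d) (suc d)))
  (ℚ.fromℚᵘ-cong {mkℚᵘ (+ suc d) d} {mkℚᵘ (+ 1) 0} (*≡* (ℤ.*-comm (+ suc d) (+ 1))))

recip-pos : ∀ d .{{_ : ℕ.NonZero d}} → 0ℚ ℚ.< recip d
recip-pos d = ℚ.positive⁻¹ (recip d) {{ℚ.normalize-pos 1 d}}

-- Turns a rational difference into the image of a natural number, whose sign is known.
ι-∸ : ∀ {k m} → k ℕ.≤ m → ι m ℚ.- ι k ≡ ι (m ℕ.∸ k)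
ι-∸ {k} {m} k≤m = trans (sym (⟦⟧-− (+ m) (+ k)))
  (cong ⟦_⟧ (trans (ℤ.m-n≡m⊖n m k) (ℤ.⊖-≥ k≤m)))

ι-≤ : ∀ {k m} → k ℕ.≤ m → 0ℚ ℚ.≤ ι m ℚ.- ι k
ι-≤ {k} {m} k≤m = subst (0ℚ ℚ.≤_) (sym (ι-∸ k≤m))
  (ℚ.nonNegative⁻¹ _ {{ℚ.normalize-nonNeg (m ℕ.∸ k) 1}})

ι-nonNeg : ∀ m → 0ℚ ℚ.≤ ι m
ι-nonNeg m = ℚ.nonNegative⁻¹ (ι m) {{ℚ.normalize-nonNeg m 1}}

ι-< : ∀ {k m} → k ℕ.< m → 0ℚ ℚ.< ι m ℚ.- ι k
ι-< {k} {m} k<m = subst (0ℚ ℚ.<_) (sym (ι-∸ (ℕ.<⇒≤ k<m)))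
  (ℚ.positive⁻¹ _ {{ℚ.normalize-pos (m ℕ.∸ k) 1 {{_}} {{ℕ.>-nonZero (ℕ.m<n⇒0<n∸m k<m)}}}})

-- Dual prices and the factorization of the slack.

-- Below, D, I, J stand for Δ, i, j and r, u, v for their reciprocals; the indices
-- ₒ and ₛ refer to the order and size constraints.
priceₒ : ℚ → ℚ
priceₒ D = ι 4 ℚ.* D ℚ.- ι 6

priceₛ : ℚ → ℚ → ℚ
priceₛ D r = (D ℚ.- ι 1) ℚ.* (D ℚ.- ι 1) ℚ.- priceₒ D ℚ.* (ι 1 ℚ.+ r)

-- The third factor is 2D − 3 − I, split so that it is visibly positive.
slackₗ : ℚ → ℚ → ℚ → ℚ
slackₗ I D u = (I ℚ.- ι 1) ℚ.* (I ℚ.- ι 2) ℚ.* (((D ℚ.- ι 4) ℚ.+ (D ℚ.- I)) ℚ.+ ι 1) ℚ.* u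

slackᵤ : ℚ → ℚ → ℚ → ℚ → ℚ → ℚ
slackᵤ I J D v r = (D ℚ.- J) ℚ.* (priceₒ D ℚ.* v ℚ.* r ℚ.+ ((D ℚ.- I) ℚ.+ (J ℚ.- I)))

slack-identity : ∀ I J D u v r → I ℚ.* u ≡ 1ℚ → J ℚ.* v ≡ 1ℚ → D ℚ.* r ≡ 1ℚ →
  (I ℚ.- J) ℚ.* (I ℚ.- J)
    ≡ priceₒ D ℚ.* (u ℚ.+ v) ℚ.+ priceₛ D r ℚ.- (slackₗ I D u ℚ.+ slackᵤ I J D v r)
slack-identity I J D u v r Iu Jv Dr = begin
  (I ℚ.- J) ℚ.* (I ℚ.- J)
    ≡⟨ solve 6 (λ I J D u v r → let a = con (ι 4) :* D :- con (ι 6) in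
         (I :- J) :* (I :- J) :=
         a :* (u :+ v) :+ ((D :- con (ι 1)) :* (D :- con (ι 1)) :- a :* (con (ι 1) :+ r))
           :- (((I :- con (ι 1)) :* (con (ι 2) :* D :- I :- con (ι 1)) :- a) :* con 1ℚ :+ a :* u
             :+ (a :* v :* con 1ℚ :- a :* r :* con 1ℚ) :+ (D :- J) :* (D :+ J :- con (ι 2) :* I)))
         refl I J D u v r ⟩
  base ℚ.- reduced 1ℚ 1ℚ 1ℚ
    -- With these products in place of 1, `(I - 1)(I - 2) u` factors out of the first two terms of
    -- `reduced` and `D - J` out of the rest.
    ≡⟨ cong (λ s → base ℚ.- s) (trans (cong₂ (λ α β → reduced α β 1ℚ) (sym Iu) (sym Jv))
         (cong (reduced (I ℚ.* u) (J ℚ.* v)) (sym Dr))) ⟩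
  base ℚ.- reduced (I ℚ.* u) (J ℚ.* v) (D ℚ.* r)
    ≡⟨ cong (λ s → base ℚ.- s) (solve 6 (λ I J D u v r → let a = con (ι 4) :* D :- con (ι 6) in
         ((I :- con (ι 1)) :* (con (ι 2) :* D :- I :- con (ι 1)) :- a) :* (I :* u) :+ a :* u
             :+ (a :* v :* (D :* r) :- a :* r :* (J :* v)) :+ (D :- J) :* (D :+ J :- con (ι 2) :* I)
         := (I :- con (ι 1)) :* (I :- con (ι 2)) :* (((D :- con (ι 4)) :+ (D :- I)) :+ con (ι 1)) :* u
           :+ (D :- J) :* (a :* v :* r :+ ((D :- I) :+ (J :- I))))
         refl I J D u v r) ⟩
  base ℚ.- (slackₗ I D u ℚ.+ slackᵤ I J D v r) ∎
  where
  open ≡-Reasoning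
  base : ℚ
  base = priceₒ D ℚ.* (u ℚ.+ v) ℚ.+ priceₛ D r
  -- The slack with I u, J v and D r as separate arguments, so that both remaining
  -- steps are ring identities.
  reduced : ℚ → ℚ → ℚ → ℚ
  reduced α β γ =
    ((I ℚ.- ι 1) ℚ.* (ι 2 ℚ.* D ℚ.- I ℚ.- ι 1) ℚ.- priceₒ D) ℚ.* α ℚ.+ priceₒ D ℚ.* u
      ℚ.+ (priceₒ D ℚ.* v ℚ.* γ ℚ.- priceₒ D ℚ.* r ℚ.* β) ℚ.+ (D ℚ.- J) ℚ.* (D ℚ.+ J ℚ.- ι 2 ℚ.* I)

-- Classification of degree pairs.

recip-cong : ∀ {d e} .{{_ : ℕ.NonZero d}} .{{_ : ℕ.NonZero e}} → d ≡ e → recip d ≡ recip e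
recip-cong refl = refl

pair-≡ : ∀ {Δ} (p q : DegreePair Δ) → i p ≡ i q → j p ≡ j q → p ≡ q
pair-≡ ⟨ u , l ⟩ ⟨ u′ , l′ ⟩ i≡ j≡ with Fin.toℕ-injective (ℕ.suc-injective j≡)
... | refl = cong ⟨ u ,_⟩ (Fin.toℕ-injective (ℕ.suc-injective i≡))

i≤j : ∀ {Δ} (p : DegreePair Δ) → i p ℕ.≤ j p
i≤j ⟨ u , l ⟩ = Fin.toℕ<n l

j≤Δ : ∀ {Δ} (p : DegreePair Δ) → j p ℕ.≤ Δ
j≤Δ ⟨ u , l ⟩ = Fin.toℕ<n u

-- Each alternative makes one slack summand positive: the first `slackₗ`, the second `slackᵤ`.
Loose : ∀ {Δ} → DegreePair Δ → Set
Loose {Δ} p = 3 ℕ.≤ i p ⊎ j p ℕ.< Δ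

-- The tight pairs (1 , Δ) and (2 , Δ), called leaf and link, and the remaining ones.
data Class {Δ} (p : DegreePair Δ) : Set where
  leaf  : i p ≡ 1 → j p ≡ Δ → Class p
  link  : i p ≡ 2 → j p ≡ Δ → Class p
  loose : Loose p → Class p

classify : ∀ {Δ} (p : DegreePair Δ) → Class p
classify {Δ} p with j p ℕ.≟ Δ
... | no j≢Δ = loose (inj₂ (ℕ.≤∧≢⇒< (j≤Δ p) j≢Δ))
... | yes j≡Δ = go (i p) refl
  where
  go : ∀ k → i p ≡ k → Class p
  go 0 ()
  go 1 eq = leaf eq j≡Δ
  go 2 eq = link eq j≡Δ
  go (suc (suc (suc k))) eq = loose (inj₁ (ℕ.≤-trans (s≤s (s≤s (s≤s z≤n))) (ℕ.≤-reflexive (sym eq))))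

costℚ weightℚ : ∀ {Δ} → DegreePair Δ → ℚ
costℚ p = ⟦ (+ i p ℤ.- + j p) ℤ.^ 2 ⟧
weightℚ p = recip (i p) ℚ.+ recip (j p)

⌊⌋-true : ∀ {A : Set} (d : Dec A) → A → ⌊ d ⌋ ≡ true
⌊⌋-true (yes _) _ = refl
⌊⌋-true (no ¬a) a = contradiction a ¬a

⌊⌋-false : ∀ {A : Set} (d : Dec A) → ¬ A → ⌊ d ⌋ ≡ false
⌊⌋-false (yes a) ¬a = contradiction a ¬a
⌊⌋-false (no _) _ = refl

-- Arithmetic of the two tight pairs.

slackₗ-1 : ∀ D u → slackₗ (ι 1) D u ≡ 0ℚ
slackₗ-1 = solve 2 (λ D u →
  (con (ι 1) :- con (ι 1)) :* (con (ι 1) :- con (ι 2))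
    :* (((D :- con (ι 4)) :+ (D :- con (ι 1))) :+ con (ι 1)) :* u := con 0ℚ) refl

slackₗ-2 : ∀ D u → slackₗ (ι 2) D u ≡ 0ℚ
slackₗ-2 = solve 2 (λ D u →
  (con (ι 2) :- con (ι 1)) :* (con (ι 2) :- con (ι 2))
    :* (((D :- con (ι 4)) :+ (D :- con (ι 2))) :+ con (ι 1)) :* u := con 0ℚ) refl

-- The two nontrivial values of `solution`, with division by Δ replaced by multiplication by `r` to
-- suit the ring solver.
leaves links : ℚ → ℚ → ℚ → ℚ
leaves D r N = ((D ℚ.- ι 2) ℚ.* N ℚ.+ (D ℚ.+ ι 2)) ℚ.* r
links D r N = (ι 2 ℚ.* (N ℚ.- D ℚ.- ι 1)) ℚ.* r

leaves+links : ∀ D r N → D ℚ.* r ≡ 1ℚ → leaves D r N ℚ.+ links D r N ≡ N ℚ.- ι 1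
leaves+links D r N Dr≡1 = trans
  (solve 3 (λ D r N →
    ((D :- con (ι 2)) :* N :+ (D :+ con (ι 2))) :* r
      :+ (con (ι 2) :* (N :- D :- con (ι 1))) :* r
    := (D :* r) :* (N :- con (ι 1))) refl D r N)
  (trans (cong (ℚ._* (N ℚ.- ι 1)) Dr≡1) (ℚ.*-identityˡ (N ℚ.- ι 1)))

-- The two values total N - 1, so the `r` parts of the weights contribute r (N - 1); the parts 1 and
-- 1/2 contribute N - r (N - 1).
weighted-leaves+links : ∀ D r N → D ℚ.* r ≡ 1ℚ →
  (recip 1 ℚ.+ r) ℚ.* leaves D r N ℚ.+ (recip 2 ℚ.+ r) ℚ.* links D r N ≡ N
weighted-leaves+links D r N Dr≡1 = begin
  (recip 1 ℚ.+ r) ℚ.* leaves D r N ℚ.+ (recip 2 ℚ.+ r) ℚ.* links D r N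
    ≡⟨ solve 3 (λ D r N →
         (con (recip 1) :+ r) :* (((D :- con (ι 2)) :* N :+ (D :+ con (ι 2))) :* r)
           :+ (con (recip 2) :+ r) :* ((con (ι 2) :* (N :- D :- con (ι 1))) :* r)
         := (D :* r) :* N :+ r :* ((D :* r) :* (N :- con (ι 1))) :- r :* (N :- con (ι 1)))
         refl D r N ⟩
  reduced (D ℚ.* r)
    ≡⟨ cong reduced Dr≡1 ⟩
  reduced 1ℚ
    ≡⟨ solve 2 (λ r N →
         con 1ℚ :* N :+ r :* (con 1ℚ :* (N :- con (ι 1))) :- r :* (N :- con (ι 1)) := N)
         refl r N ⟩
  N ∎
  where
  open ≡-Reasoning
  reduced : ℚ → ℚ
  reduced t = t ℚ.* N ℚ.+ r ℚ.* (t ℚ.* (N ℚ.- ι 1)) ℚ.- r ℚ.* (N ℚ.- ι 1)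

-- The common `r` cancels and 1 - 1/2 remains. As the tight weights differ, the two constraints are
-- independent on the tight pairs.
weight-gap : ∀ r → ι 2 ℚ.* ((recip 1 ℚ.+ r) ℚ.- (recip 2 ℚ.+ r)) ≡ 1ℚ
weight-gap = solve 1 (λ r →
  con (ι 2) :* ((con (recip 1) :+ r) :- (con (recip 2) :+ r)) := con 1ℚ) refl

weight-gap⁻ : ∀ r → (ℚ.- ι 2) ℚ.* ((recip 2 ℚ.+ r) ℚ.- (recip 1 ℚ.+ r)) ≡ 1ℚ
weight-gap⁻ = solve 1 (λ r →
  (:- con (ι 2)) :* ((con (recip 2) :+ r) :- (con (recip 1) :+ r)) := con 1ℚ) refl

priceₒ-pos : ∀ D → 0ℚ ℚ.≤ D ℚ.- ι 4 → 0ℚ ℚ.< priceₒ D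
priceₒ-pos D 4≤D = subst (0ℚ ℚ.<_)
  (solve 1 (λ D → con (ι 4) :* (D :- con (ι 4)) :+ con (ι 10) := con (ι 4) :* D :- con (ι 6)) refl D)
  (ℚ.+-mono-≤-< (*-nonNeg (ι-nonNeg 4) 4≤D) (ℚ.positive⁻¹ (ι 10)))

-- Sign of the dual slack, with Δ = 4 + κ.

module _ (κ n : ℕ) where
  private
    Δ : ℕ
    Δ = 4 ℕ.+ κ

    D r N : ℚ
    D = ι Δ
    r = recip Δ
    N = ι n

  4≤D : 0ℚ ℚ.≤ D ℚ.- ι 4
  4≤D = ι-≤ {4} {Δ} (ℕ.m≤m+n 4 κ)

  slack : DegreePair Δ → ℚ
  slack p = slackₗ (ι (i p)) D (recip (i p)) ℚ.+ slackᵤ (ι (i p)) (ι (j p)) D (recip (j p)) r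

  cost≡ : ∀ p → costℚ p ≡ priceₒ D ℚ.* weightℚ p ℚ.+ priceₛ D r ℚ.- slack p
  cost≡ p = trans square
    (slack-identity (ι (i p)) (ι (j p)) D (recip (i p)) (recip (j p)) r
      (ι*recip (i p)) (ι*recip (j p)) (ι*recip Δ))
    where
    x : ℤ
    x = + i p ℤ.- + j p
    square : costℚ p ≡ (ι (i p) ℚ.- ι (j p)) ℚ.* (ι (i p) ℚ.- ι (j p))
    square = trans (⟦⟧-* x (x ℤ.^ 1)) (cong₂ ℚ._*_ (⟦⟧-− (+ i p) (+ j p))
      (trans (cong ⟦_⟧ (ℤ.*-identityʳ x)) (⟦⟧-− (+ i p) (+ j p))))

  i≤Δ : ∀ (p : DegreePair Δ) → i p ℕ.≤ Δ
  i≤Δ p = ℕ.≤-trans (i≤j p) (j≤Δ p)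

  slackₗ-pos : ∀ p → 3 ℕ.≤ i p → 0ℚ ℚ.< slackₗ (ι (i p)) D (recip (i p))
  slackₗ-pos p 3≤i = *-pos (*-pos (*-pos (ι-< (ℕ.≤-trans (s≤s (s≤s z≤n)) 3≤i)) (ι-< 3≤i))
    (ℚ.+-mono-≤-< (ℚ.+-mono-≤ 4≤D (ι-≤ (i≤Δ p))) (ℚ.positive⁻¹ (ι 1))))
    (recip-pos (i p))

  -- The factor (i - 1)(i - 2) would be negative strictly between its roots; a positive integer i is
  -- either a root or at least 3.
  slackₗ-nonNeg : ∀ p → 0ℚ ℚ.≤ slackₗ (ι (i p)) D (recip (i p))
  slackₗ-nonNeg p = go (i p) refl
    where
    go : ∀ k → i p ≡ k → 0ℚ ℚ.≤ slackₗ (ι (i p)) D (recip (i p))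
    go 0 ()
    go 1 eq = ℚ.≤-reflexive (sym (trans (cong (λ z → slackₗ (ι z) D (recip (i p))) eq) (slackₗ-1 D _)))
    go 2 eq = ℚ.≤-reflexive (sym (trans (cong (λ z → slackₗ (ι z) D (recip (i p))) eq) (slackₗ-2 D _)))
    go (suc (suc (suc k))) eq = ℚ.<⇒≤ (slackₗ-pos p (subst (3 ℕ.≤_) (sym eq) (s≤s (s≤s (s≤s z≤n)))))

  slackᵤ-factor-pos : ∀ (p : DegreePair Δ) →
    0ℚ ℚ.< priceₒ D ℚ.* recip (j p) ℚ.* r ℚ.+ ((D ℚ.- ι (i p)) ℚ.+ (ι (j p) ℚ.- ι (i p)))
  slackᵤ-factor-pos p = ℚ.+-mono-<-≤ (*-pos (*-pos (priceₒ-pos D 4≤D) (recip-pos (j p))) (recip-pos Δ))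
    (ℚ.+-mono-≤ (ι-≤ (i≤Δ p)) (ι-≤ (i≤j p)))

  slackᵤ-nonNeg : ∀ p → 0ℚ ℚ.≤ slackᵤ (ι (i p)) (ι (j p)) D (recip (j p)) r
  slackᵤ-nonNeg p = *-nonNeg (ι-≤ (j≤Δ p)) (ℚ.<⇒≤ (slackᵤ-factor-pos p))

  slack-nonNeg : ∀ p → 0ℚ ℚ.≤ slack p
  slack-nonNeg p = ℚ.+-mono-≤ (slackₗ-nonNeg p) (slackᵤ-nonNeg p)

  slack-pos : ∀ p → Loose p → 0ℚ ℚ.< slack p
  slack-pos p (inj₁ 3≤i) = ℚ.+-mono-<-≤ (slackₗ-pos p 3≤i) (slackᵤ-nonNeg p)
  slack-pos p (inj₂ j<Δ) = ℚ.+-mono-≤-< (slackₗ-nonNeg p) (*-pos (ι-< j<Δ) (slackᵤ-factor-pos p))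

  slackᵤ-0 : ∀ (p : DegreePair Δ) → j p ≡ Δ → slackᵤ (ι (i p)) (ι (j p)) D (recip (j p)) r ≡ 0ℚ
  slackᵤ-0 p eq = trans (cong (ℚ._* X) (trans (cong (λ z → D ℚ.- ι z) eq) (ℚ.+-inverseʳ D))) (ℚ.*-zeroˡ X)
    where
    X : ℚ
    X = priceₒ D ℚ.* recip (j p) ℚ.* r ℚ.+ ((D ℚ.- ι (i p)) ℚ.+ (ι (j p) ℚ.- ι (i p)))

  slack-leaf : ∀ p → i p ≡ 1 → j p ≡ Δ → slack p ≡ 0ℚ
  slack-leaf p i≡1 j≡Δ = cong₂ ℚ._+_
    (trans (cong (λ z → slackₗ (ι z) D (recip (i p))) i≡1) (slackₗ-1 D _)) (slackᵤ-0 p j≡Δ)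

  slack-link : ∀ p → i p ≡ 2 → j p ≡ Δ → slack p ≡ 0ℚ
  slack-link p i≡2 j≡Δ = cong₂ ℚ._+_
    (trans (cong (λ z → slackₗ (ι z) D (recip (i p))) i≡2) (slackₗ-2 D _)) (slackᵤ-0 p j≡Δ)

  -- Values and feasibility of the claimed solution.

  solution-leaf : ∀ p k → i p ≡ 1 → j p ≡ Δ → seq (solution Δ n p) k ≡ leaves D r N
  solution-leaf p k i≡1 j≡Δ
    rewrite ⌊⌋-true (i p ℕ.≟ 1) i≡1 | ⌊⌋-true (j p ℕ.≟ Δ) j≡Δ =
    trans (/≡*recip ((+ Δ ℤ.- + 2) ℤ.* + n ℤ.+ (+ Δ ℤ.+ + 2)) Δ) (cong (ℚ._* r)
      (trans (⟦⟧-+ ((+ Δ ℤ.- + 2) ℤ.* + n) (+ Δ ℤ.+ + 2)) (cong₂ ℚ._+_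
        (trans (⟦⟧-* (+ Δ ℤ.- + 2) (+ n)) (cong (ℚ._* N) (⟦⟧-− (+ Δ) (+ 2)))) (⟦⟧-+ (+ Δ) (+ 2)))))

  solution-link : ∀ p k → i p ≡ 2 → j p ≡ Δ → seq (solution Δ n p) k ≡ links D r N
  solution-link p k i≡2 j≡Δ
    rewrite ⌊⌋-false (i p ℕ.≟ 1) (λ i≡1 → ℕ.1+n≢n (trans (sym i≡2) i≡1))
          | ⌊⌋-true (i p ℕ.≟ 2) i≡2 | ⌊⌋-true (j p ℕ.≟ Δ) j≡Δ =
    trans (/≡*recip (+ 2 ℤ.* (+ n ℤ.- + Δ ℤ.- + 1)) Δ) (cong (ℚ._* r)
      (trans (⟦⟧-* (+ 2) (+ n ℤ.- + Δ ℤ.- + 1)) (cong (ι 2 ℚ.*_)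
        (trans (⟦⟧-− (+ n ℤ.- + Δ) (+ 1)) (cong (ℚ._- ι 1) (⟦⟧-− (+ n) (+ Δ)))))))

  solution-loose : ∀ p k → Loose p → seq (solution Δ n p) k ≡ 0ℚ
  solution-loose p k (inj₁ 3≤i)
    rewrite ⌊⌋-false (i p ℕ.≟ 1) (λ eq → ℕ.<⇒≢ (ℕ.≤-trans (s≤s (s≤s z≤n)) 3≤i) (sym eq))
          | ⌊⌋-false (i p ℕ.≟ 2) (λ eq → ℕ.<⇒≢ 3≤i (sym eq)) = refl
  solution-loose p k (inj₂ j<Δ)
    rewrite ⌊⌋-false (j p ℕ.≟ Δ) (ℕ.<⇒≢ j<Δ)
    -- `_∧_` computes on its first argument, so the tests on i must be split even though the test on
    -- j is already false.
    with ⌊ i p ℕ.≟ 1 ⌋ | ⌊ i p ℕ.≟ 2 ⌋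
  ... | true  | true  = refl
  ... | true  | false = refl
  ... | false | true  = refl
  ... | false | false = refl

  apex : Fin Δ
  apex = fromℕ (3 ℕ.+ κ)

  toℕ-apex : suc (toℕ apex) ≡ Δ
  toℕ-apex = cong suc (Fin.toℕ-fromℕ (3 ℕ.+ κ))

  -- Because Δ is literally `4 + κ`, `toℕ apex` computes to a successor and `suc zero` is a valid
  -- lower index.
  leafPair linkPair : DegreePair Δ
  leafPair = ⟨ apex , zero ⟩
  linkPair = ⟨ apex , suc zero ⟩

  sumₚ-tight : ∀ (f : DegreePair Δ → ℚ) →
    (∀ p → Loose p → f p ≡ 0ℚ) → sumₚ f ≡ f leafPair ℚ.+ f linkPair
  sumₚ-tight f f≡0 = trans
    (sum-single (λ u → sum λ l → f ⟨ u , l ⟩) apex λ u u≢ →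
      sum-0 (λ l → f ⟨ u , l ⟩) λ l → f≡0 ⟨ u , l ⟩ (inj₂ (ℕ.≤∧≢⇒< (Fin.toℕ<n u)
        (λ eq → u≢ (Fin.toℕ-injective (ℕ.suc-injective (trans eq (sym toℕ-apex))))))))
    (cong (f leafPair ℚ.+_) (trans
      (cong (f linkPair ℚ.+_) (sum-0 (λ l → f ⟨ apex , suc (suc l) ⟩)
        λ l → f≡0 ⟨ apex , suc (suc l) ⟩ (inj₁ (s≤s (s≤s (s≤s z≤n))))))
      (ℚ.+-identityʳ (f linkPair))))

  sol : ℕ → DegreePair Δ → ℚ
  sol k p = seq (solution Δ n p) k

  sol-size : ∀ k → sumₚ (sol k) ≡ ⟦ + n ℤ.- + 1 ⟧
  sol-size k = begin
    sumₚ (sol k)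
      ≡⟨ sumₚ-tight (sol k) (λ p → solution-loose p k) ⟩
    sol k leafPair ℚ.+ sol k linkPair
      ≡⟨ cong₂ ℚ._+_ (solution-leaf leafPair k refl toℕ-apex) (solution-link linkPair k refl toℕ-apex) ⟩
    leaves D r N ℚ.+ links D r N
      ≡⟨ leaves+links D r N (ι*recip Δ) ⟩
    N ℚ.- ι 1
      ≡⟨ ⟦⟧-− (+ n) (+ 1) ⟨
    ⟦ + n ℤ.- + 1 ⟧ ∎
    where open ≡-Reasoning

  weight-leaf : ∀ (p : DegreePair Δ) → i p ≡ 1 → j p ≡ Δ → weightℚ p ≡ recip 1 ℚ.+ r
  weight-leaf p i≡1 j≡Δ = cong₂ ℚ._+_ (recip-cong i≡1) (recip-cong j≡Δ)

  weight-link : ∀ (p : DegreePair Δ) → i p ≡ 2 → j p ≡ Δ → weightℚ p ≡ recip 2 ℚ.+ r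
  weight-link p i≡2 j≡Δ = cong₂ ℚ._+_ (recip-cong i≡2) (recip-cong j≡Δ)

  sol-order : ∀ k → sumₚ (λ p → weightℚ p ℚ.* sol k p) ≡ N
  sol-order k = begin
    sumₚ (λ p → weightℚ p ℚ.* sol k p)
      ≡⟨ sumₚ-tight (λ p → weightℚ p ℚ.* sol k p) (λ p h →
           trans (cong (weightℚ p ℚ.*_) (solution-loose p k h)) (ℚ.*-zeroʳ (weightℚ p))) ⟩
    weightℚ leafPair ℚ.* sol k leafPair ℚ.+ weightℚ linkPair ℚ.* sol k linkPair
      ≡⟨ cong₂ ℚ._+_
           (cong₂ ℚ._*_ (weight-leaf leafPair refl toℕ-apex) (solution-leaf leafPair k refl toℕ-apex))
           (cong₂ ℚ._*_ (weight-link linkPair refl toℕ-apex) (solution-link linkPair k refl toℕ-apex)) ⟩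
    (recip 1 ℚ.+ r) ℚ.* leaves D r N ℚ.+ (recip 2 ℚ.+ r) ℚ.* links D r N
      ≡⟨ weighted-leaves+links D r N (ι*recip Δ) ⟩
    N ∎
    where open ≡-Reasoning

  -- Complementary slackness: the slack vanishes on the tight pairs and the solution vanishes on the
  -- loose ones.
  slack*sol : ∀ k p → slack p ℚ.* sol k p ≡ 0ℚ
  slack*sol k p = go (classify p)
    where
    go : Class p → slack p ℚ.* sol k p ≡ 0ℚ
    go (leaf i≡1 j≡Δ) = trans (cong (ℚ._* sol k p) (slack-leaf p i≡1 j≡Δ)) (ℚ.*-zeroˡ (sol k p))
    go (link i≡2 j≡Δ) = trans (cong (ℚ._* sol k p) (slack-link p i≡2 j≡Δ)) (ℚ.*-zeroˡ (sol k p))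
    go (loose h)      = trans (cong (slack p ℚ.*_) (solution-loose p k h)) (ℚ.*-zeroʳ (slack p))

  sol-nonNeg : Δ ℕ.+ 2 ℕ.≤ n → ∀ k p → 0ℚ ℚ.≤ sol k p
  sol-nonNeg Δ+2≤n k p = go (classify p)
    where
    go : Class p → 0ℚ ℚ.≤ sol k p
    go (leaf i≡1 j≡Δ) = subst (0ℚ ℚ.≤_) (sym (solution-leaf p k i≡1 j≡Δ))
      (*-nonNeg (ℚ.+-mono-≤ (*-nonNeg (ι-≤ {2} {Δ} (ℕ.m≤m+n 2 _)) (ι-nonNeg n))
        (ℚ.+-mono-≤ (ι-nonNeg Δ) (ι-nonNeg 2))) (ℚ.<⇒≤ (recip-pos Δ)))
    -- The lower bound on n enters here: it gives n - Δ at least 2, so n - Δ - 1 is nonnegative.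
    go (link i≡2 j≡Δ) = subst (0ℚ ℚ.≤_) (sym (solution-link p k i≡2 j≡Δ))
      (*-nonNeg (*-nonNeg (ι-nonNeg 2) (subst (λ t → 0ℚ ℚ.≤ t ℚ.- ι 1)
        (sym (ι-∸ {Δ} {n} (ℕ.m+n≤o⇒m≤o Δ Δ+2≤n)))
        (ι-≤ {1} {n ℕ.∸ Δ} (ℕ.≤-trans (ℕ.n≤1+n 1)
          (ℕ.m+n≤o⇒m≤o∸n 2 (subst (ℕ._≤ n) (ℕ.+-comm Δ 2) Δ+2≤n))))))
        (ℚ.<⇒≤ (recip-pos Δ)))
    go (loose h) = ℚ.≤-reflexive (sym (solution-loose p k h))

  solution-feasible : Δ ℕ.+ 2 ℕ.≤ n → Feasible Δ n (solution Δ n)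
  solution-feasible Δ+2≤n = record
    { order = null⇒≃ (∑ₚ λ p → weight p * solution Δ n p) (fromℤ (+ n)) (null-0 λ k →
        trans (cong (ℚ._- N) (trans (seq-∑ₚ (λ p → weight p * solution Δ n p) k) (sol-order k)))
          (ℚ.+-inverseʳ N))
    ; size = null⇒≃ (∑ₚ (solution Δ n)) (fromℤ (+ n ℤ.- + 1)) (null-0 λ k →
        trans (cong (ℚ._- ⟦ + n ℤ.- + 1 ⟧) (trans (seq-∑ₚ (solution Δ n) k) (sol-size k)))
          (ℚ.+-inverseʳ ⟦ + n ℤ.- + 1 ⟧))
    ; nonneg = λ p → limSup⇒≤ 0ℝ (solution Δ n p) (limSup-nonPos λ k →
        ℚ.≤-trans (ℚ.≤-reflexive (ℚ.+-identityˡ (ℚ.- sol k p)))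
          (ℚ.neg-antimono-≤ (sol-nonNeg Δ+2≤n k p)))
    }

  -- The duality identity.

  -- Summing `cost≡` against `x`. No constraint is imposed on `x`, so the identity can be applied at
  -- each index to the deviation of a feasible assignment from the solution.
  dual : ∀ (x : DegreePair Δ → ℚ) → sumₚ (λ p → costℚ p ℚ.* x p)
    ≡ priceₒ D ℚ.* sumₚ (λ p → weightℚ p ℚ.* x p) ℚ.+ priceₛ D r ℚ.* sumₚ x
      ℚ.- sumₚ (λ p → slack p ℚ.* x p)
  dual x = begin
    sumₚ (λ p → costℚ p ℚ.* x p)
      ≡⟨ sumₚ-cong (λ p → trans (cong (ℚ._* x p) (cost≡ p))
           -- The sum `b x` is written as subtraction of `(- b) x`, so that `sumₚ-−` handles both
           -- splittings.
           (solve 5 (λ a w b s x → (a :* w :+ b :- s) :* x := (a :* (w :* x) :- (:- b) :* x) :- s :* x)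
             refl (priceₒ D) (weightℚ p) (priceₛ D r) (slack p) (x p))) ⟩
    sumₚ (λ p → (priceₒ D ℚ.* (weightℚ p ℚ.* x p) ℚ.- (ℚ.- priceₛ D r) ℚ.* x p) ℚ.- slack p ℚ.* x p)
      ≡⟨ sumₚ-− (λ p → priceₒ D ℚ.* (weightℚ p ℚ.* x p) ℚ.- (ℚ.- priceₛ D r) ℚ.* x p)
           (λ p → slack p ℚ.* x p) ⟩
    sumₚ (λ p → priceₒ D ℚ.* (weightℚ p ℚ.* x p) ℚ.- (ℚ.- priceₛ D r) ℚ.* x p) ℚ.- S
      ≡⟨ cong (λ t → t ℚ.- S) (sumₚ-− (λ p → priceₒ D ℚ.* (weightℚ p ℚ.* x p))
           (λ p → (ℚ.- priceₛ D r) ℚ.* x p)) ⟩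
    sumₚ (λ p → priceₒ D ℚ.* (weightℚ p ℚ.* x p)) ℚ.- sumₚ (λ p → (ℚ.- priceₛ D r) ℚ.* x p) ℚ.- S
      ≡⟨ cong₂ (λ s t → s ℚ.- t ℚ.- S) (sumₚ-* (priceₒ D) (λ p → weightℚ p ℚ.* x p))
           (sumₚ-* (ℚ.- priceₛ D r) x) ⟩
    priceₒ D ℚ.* sumₚ (λ p → weightℚ p ℚ.* x p) ℚ.- (ℚ.- priceₛ D r) ℚ.* sumₚ x ℚ.- S
      ≡⟨ solve 4 (λ w b x s → w :- (:- b) :* x :- s := w :+ b :* x :- s) refl
           (priceₒ D ℚ.* sumₚ (λ p → weightℚ p ℚ.* x p)) (priceₛ D r) (sumₚ x) S ⟩
    priceₒ D ℚ.* sumₚ (λ p → weightℚ p ℚ.* x p) ℚ.+ priceₛ D r ℚ.* sumₚ x ℚ.- S ∎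
    where
    open ≡-Reasoning
    S : ℚ
    S = sumₚ (λ p → slack p ℚ.* x p)

  -- Optimality of the solution.

  module _ (m : Assignment Δ) (m-feasible : Feasible Δ n m) where

    -- A feasible `m` meets the equality constraints only in the limit, the solution at every index.
    -- In the difference the right-hand sides cancel and null sequences remain.
    dev : ℕ → DegreePair Δ → ℚ
    dev k p = seq (m p) k ℚ.- sol k p

    -- Rational coefficients cover both uses: `weight p` and `cost p` are by definition `fromℚ` of
    -- `weightℚ p` and `costℚ p`.
    sumₚ-dev : ∀ (c : DegreePair Δ → ℚ) k → sumₚ (λ p → c p ℚ.* dev k p)
      ≡ seq (∑ₚ λ p → fromℚ (c p) * m p) k ℚ.- seq (∑ₚ λ p → fromℚ (c p) * solution Δ n p) k
    sumₚ-dev c k = trans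
      (sumₚ-cong λ p → solve 3 (λ c x y → c :* (x :- y) := c :* x :- c :* y) refl
        (c p) (seq (m p) k) (sol k p))
      (trans (sumₚ-− (λ p → c p ℚ.* seq (m p) k) (λ p → c p ℚ.* sol k p))
        (sym (cong₂ ℚ._-_ (seq-∑ₚ (λ p → fromℚ (c p) * m p) k)
          (seq-∑ₚ (λ p → fromℚ (c p) * solution Δ n p) k))))

    order-null : Null (λ k → sumₚ (λ p → weightℚ p ℚ.* dev k p))
    order-null = null-resp
      (λ k → sym (trans (sumₚ-dev weightℚ k)
        (cong (λ t → seq (∑ₚ λ p → weight p * m p) k ℚ.- t)
          (trans (seq-∑ₚ (λ p → weight p * solution Δ n p) k) (sol-order k)))))
      (≃⇒null (∑ₚ λ p → weight p * m p) (fromℤ (+ n)) (Feasible.order m-feasible))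

    size-null : Null (λ k → sumₚ (dev k))
    size-null = null-resp
      (λ k → sym (trans (sumₚ-− (λ p → seq (m p) k) (sol k))
        (cong₂ ℚ._-_ (sym (seq-∑ₚ m k)) (sol-size k))))
      (≃⇒null (∑ₚ m) (fromℤ (+ n ℤ.- + 1)) (Feasible.size m-feasible))

    -- By complementary slackness, slack times deviation equals slack times `m p` at every index,
    -- and `m p` is nonnegative as a real.
    slack-dev : ∀ p → LimSup≤0 (λ k → ℚ.- (slack p ℚ.* dev k p))
    slack-dev p = limSup-resp
      (λ k → trans (solve 3 (λ s x y → s :* (con 0ℚ :- x) := :- (s :* (x :- y)) :- s :* y) refl
          (slack p) (seq (m p) k) (sol k p))
        (trans (cong (λ t → ℚ.- (slack p ℚ.* dev k p) ℚ.- t) (slack*sol k p))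
          (ℚ.+-identityʳ (ℚ.- (slack p ℚ.* dev k p)))))
      (limSup-* (slack p) (slack-nonNeg p) (≤⇒limSup 0ℝ (m p) (Feasible.nonneg m-feasible p)))

    priced : ℕ → ℚ
    priced k = priceₒ D ℚ.* sumₚ (λ p → weightℚ p ℚ.* dev k p) ℚ.+ priceₛ D r ℚ.* sumₚ (dev k)

    priced-null : Null priced
    priced-null = null-+ (null-* (priceₒ D) order-null) (null-* (priceₛ D r) size-null)

    objective-dev : ∀ k → seq (objective m) k ℚ.- seq (objective (solution Δ n)) k
      ≡ priced k ℚ.- sumₚ (λ p → slack p ℚ.* dev k p)
    objective-dev k = trans (sym (sumₚ-dev costℚ k)) (dual (dev k))

    -- The gap between the objectives is a null sequence, the priced constraint deviations, minus a
    -- sum of asymptotically nonnegative slack terms.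
    objective-≤ : objective m ≤ objective (solution Δ n)
    objective-≤ = limSup⇒≤ (objective m) (objective (solution Δ n))
      (limSup-resp
        (λ k → trans (cong (priced k ℚ.+_) (neg-sumₚ (λ p → slack p ℚ.* dev k p))) (sym (objective-dev k)))
        (limSup-+ (proj₁ priced-null) (limSup-sumₚ slack-dev)))

    -- Uniqueness of the optimum.

    module _ (best : objective (solution Δ n) ≤ objective m) where

      -- The duality identity solved for the slack sum: it is the null priced part plus an objective
      -- gap that `best` bounds above.
      sum-slack : LimSup≤0 (λ k → sumₚ (λ p → slack p ℚ.* dev k p))
      sum-slack = limSup-resp
        (λ k → cancel (priced k) (seq (objective (solution Δ n)) k) (seq (objective m) k)
          (sumₚ (λ p → slack p ℚ.* dev k p)) (objective-dev k))
        (limSup-+ (proj₁ priced-null) (≤⇒limSup (objective (solution Δ n)) (objective m) best))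
        where
        cancel : ∀ a x y s → y ℚ.- x ≡ a ℚ.- s → a ℚ.+ (x ℚ.- y) ≡ s
        cancel a x y s eq = trans
          (solve 3 (λ a x y → a :+ (x :- y) := a :- (y :- x)) refl a x y)
          (trans (cong (λ t → a ℚ.- t) eq) (solve 2 (λ a s → a :- (a :- s) := s) refl a s))

      -- Asymptotically nonnegative terms whose sum has nonpositive limit superior are each null;
      -- the positive slack is then cancelled.
      loose-null : ∀ p → Loose p → Null (λ k → dev k p)
      loose-null p h =
          limSup-pos*⁻¹ (slack p) (slack-pos p h) (limSup-summandₚ p sum-slack (λ q _ → slack-dev q))
        , limSup-pos*⁻¹ (slack p) (slack-pos p h)
            (limSup-resp (λ k → ℚ.neg-distribʳ-* (slack p) (dev k p)) (slack-dev p))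

      -- Subtracting ω times the size constraint from the order constraint
      -- eliminates the other tight variable.
      eliminate : ∀ p ω c → c ℚ.* (weightℚ p ℚ.- ω) ≡ 1ℚ →
        (∀ q → q ≢ p → Loose q ⊎ weightℚ q ≡ ω) → Null (λ k → dev k p)
      eliminate p ω c c*≡1 others = null-resp
        (λ k → trans (sym (ℚ.*-assoc c (weightℚ p ℚ.- ω) (dev k p)))
          (trans (cong (ℚ._* dev k p) c*≡1) (ℚ.*-identityˡ (dev k p))))
        (null-* c (null-summandₚ p
          (null-resp (λ k → sym (combine k)) (null-+ order-null (null-* (ℚ.- ω) size-null)))
          other-null))
        where
        combine : ∀ k → sumₚ (λ q → (weightℚ q ℚ.- ω) ℚ.* dev k q)
          ≡ sumₚ (λ q → weightℚ q ℚ.* dev k q) ℚ.+ (ℚ.- ω) ℚ.* sumₚ (dev k)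
        combine k = trans
          (sumₚ-cong λ q → solve 3 (λ w o x → (w :- o) :* x := w :* x :- o :* x) refl
            (weightℚ q) ω (dev k q))
          (trans (sumₚ-− (λ q → weightℚ q ℚ.* dev k q) (λ q → ω ℚ.* dev k q))
            (cong (sumₚ (λ q → weightℚ q ℚ.* dev k q) ℚ.+_)
              (trans (cong ℚ.-_ (sumₚ-* ω (dev k))) (ℚ.neg-distribˡ-* ω (sumₚ (dev k))))))
        other-null : ∀ q → q ≢ p → Null (λ k → (weightℚ q ℚ.- ω) ℚ.* dev k q)
        other-null q q≢p = [ (λ h → null-* (weightℚ q ℚ.- ω) (loose-null q h)) , vanish ]′ (others q q≢p)
          where
          vanish : weightℚ q ≡ ω → Null (λ k → (weightℚ q ℚ.- ω) ℚ.* dev k q)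
          vanish eq = null-0 λ k → trans
            (cong (ℚ._* dev k q) (trans (cong (ℚ._- ω) eq) (ℚ.+-inverseʳ ω))) (ℚ.*-zeroˡ (dev k q))

      dev-null : ∀ p → Null (λ k → dev k p)
      dev-null p = go (classify p)
        where
        go : Class p → Null (λ k → dev k p)
        go (loose h) = loose-null p h
        -- `ω` is the weight of (2 , Δ), whose coefficient thereby vanishes; `ι 2` inverts the
        -- remaining coefficient 1/2. The `link` case swaps the roles, with coefficient -1/2.
        go (leaf i≡1 j≡Δ) = eliminate p (recip 2 ℚ.+ r) (ι 2)
          (trans (cong (λ w → ι 2 ℚ.* (w ℚ.- (recip 2 ℚ.+ r))) (weight-leaf p i≡1 j≡Δ)) (weight-gap r))
          λ q q≢p → others q q≢p (classify q)
          where
          others : ∀ q → q ≢ p → Class q → Loose q ⊎ weightℚ q ≡ recip 2 ℚ.+ r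
          others q q≢p (loose h) = inj₁ h
          others q q≢p (link i≡ j≡) = inj₂ (weight-link q i≡ j≡)
          others q q≢p (leaf i≡ j≡) =
            contradiction (pair-≡ q p (trans i≡ (sym i≡1)) (trans j≡ (sym j≡Δ))) q≢p
        go (link i≡2 j≡Δ) = eliminate p (recip 1 ℚ.+ r) (ℚ.- ι 2)
          (trans (cong (λ w → (ℚ.- ι 2) ℚ.* (w ℚ.- (recip 1 ℚ.+ r))) (weight-link p i≡2 j≡Δ)) (weight-gap⁻ r))
          λ q q≢p → others q q≢p (classify q)
          where
          others : ∀ q → q ≢ p → Class q → Loose q ⊎ weightℚ q ≡ recip 1 ℚ.+ r
          others q q≢p (loose h) = inj₁ h
          others q q≢p (leaf i≡ j≡) = inj₂ (weight-leaf q i≡ j≡)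
          others q q≢p (link i≡ j≡) =
            contradiction (pair-≡ q p (trans i≡ (sym i≡2)) (trans j≡ (sym j≡Δ))) q≢p

theorem3p2 : (Δ n : ℕ) → 4 ℕ.≤ Δ → Δ ℕ.+ 2 ℕ.≤ n →
    Optimal Δ n (solution Δ n) ×
    (∀ m → Optimal Δ n m → ∀ p → m p ≃ solution Δ n p)
theorem3p2 (suc (suc (suc (suc κ)))) n (s≤s (s≤s (s≤s (s≤s z≤n)))) Δ+2≤n =
  record { feasible = feasible ; maximal = objective-≤ κ n }
  -- Maximality of `m` against the feasible solution supplies `best`.
  , λ m m-optimal p → null⇒≃ (m p) (solution (4 ℕ.+ κ) n p)
      (dev-null κ n m (Optimal.feasible m-optimal)
        (Optimal.maximal m-optimal (solution (4 ℕ.+ κ) n) feasible) p)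
  where
  feasible : Feasible (4 ℕ.+ κ) n (solution (4 ℕ.+ κ) n)
  feasible = solution-feasible κ n Δ+2≤n
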